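{- Let $k\in\mathbb{N}\setminus\{0\}$. Any lattice $\mathcal{L}$ of regular subsets of $\mathbb{N}$ which is closed under decrement is also closed under $k$-quotient; that is, $L\in\mathcal{L}$ implies $L\div k=\{x\in\mathbb{N}\mid kx\in L\}\in\mathcal{L}$.
   Context: $\mathbb{N}=\{0,1,2,\ldots\}$. A lattice over a set $X$ is any non empty family of subsets of $X$ closed under (binary) union and intersection. For $L\subseteq\mathbb{N}$ and $i\in\mathbb{N}$, $L-i=\{x\in\mathbb{N}\mid x+i\in L\}$; a family $\mathcal{L}$ of subsets of $\mathbb{N}$ is closed under decrement if $L\in\mathcal{L}$ implies $L-1\in\mathcal{L}$. A subset of $\mathbb{N}$ is regular if it is recognized by a finite automaton in unary notation; equivalently, if it is the union of a finite set with finitely many arithmetic progressions $a+r\mathbb{N}$ ($a,r\in\mathbb{N}$, $r\geq1$). -}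

module Defs where

open import Data.Fin using (Fin)
open import Data.Fin.Subset as Subset using (Subset)
open import Data.List using (List; foldl; replicate)
open import Data.Nat using (ℕ; _+_; _*_)
open import Data.Product using (Σ-syntax)
open import Data.Unit using (⊤; tt)
open import Level using (Level; 0ℓ; _⊔_) renaming (suc to lsuc)
open import Relation.Binary.Definitions using (_Respects_)
open import Relation.Unary using (Pred; _∈_; _∪_; _∩_; _≐_; Satisfiable)

-- Subsets of X are predicates on X, and two subsets are equal when they have
-- the same elements (_≐_).
Family : Set → (ℓ : Level) → Set (lsuc ℓ)
Family X ℓ = Pred (Pred X 0ℓ) ℓ

record IsLattice {X : Set} {ℓ} (𝓛 : Family X ℓ) : Set (lsuc 0ℓ ⊔ ℓ) where
  field
    -- Membership in a family depends only on the elements of a subset, not on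
    -- the predicate chosen to present it.
    resp-≐   : 𝓛 Respects _≐_
    nonEmpty : Satisfiable 𝓛
    ∪-closed : ∀ L M → L ∈ 𝓛 → M ∈ 𝓛 → (L ∪ M) ∈ 𝓛
    ∩-closed : ∀ L M → L ∈ 𝓛 → M ∈ 𝓛 → (L ∩ M) ∈ 𝓛

record Automaton (A : Set) : Set where
  field
    size  : ℕ
    start : Fin size
    step  : Fin size → A → Fin size
    final : Subset size

  Accepts : Pred (List A) 0ℓ
  Accepts w = foldl step start w Subset.∈ final

-- The unary notation of n is the word of length n over a one-letter alphabet.
unary : ℕ → List ⊤
unary n = replicate n tt

Regular : Pred (Pred ℕ 0ℓ) 0ℓ
Regular L = Σ[ M ∈ Automaton ⊤ ] L ≐ (λ n → Automaton.Accepts M (unary n))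

infixl 6 _-_
_-_ : Pred ℕ 0ℓ → ℕ → Pred ℕ 0ℓ
(L - i) x = (x + i) ∈ L

infixl 7 _÷_
_÷_ : Pred ℕ 0ℓ → ℕ → Pred ℕ 0ℓ
(L ÷ k) x = (k * x) ∈ L

ClosedUnderDecrement : ∀ {ℓ} → Family ℕ ℓ → Set (lsuc 0ℓ ⊔ ℓ)
ClosedUnderDecrement 𝓛 = ∀ L → L ∈ 𝓛 → (L - 1) ∈ 𝓛

ClosedUnderQuotient : ∀ {ℓ} → ℕ → Family ℕ ℓ → Set (lsuc 0ℓ ⊔ ℓ)
ClosedUnderQuotient k 𝓛 = ∀ L → L ∈ 𝓛 → (L ÷ k) ∈ 𝓛

{-# OPTIONS --safe #-}
-- Let a ≼ b mean that a + t ∈ L implies b + t ∈ L for every t.  Trading the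
-- k summands of k * a one at a time for b shows that k * a ∈ L and a ≼ b give
-- k * b ∈ L.  Hence L ÷ k is the union, over the a with k * a ∈ L, of the up-sets
-- { x ∣ a ≼ x }, each of which is the intersection of the L - t with a + t ∈ L.
-- An automaton for L has finitely many states, so finitely many a and t suffice.
module Submission where

open import Data.Fin using (Fin; toℕ)
open import Data.Fin.Properties using (pigeonhole)
open import Data.Fin.Subset as Subset using ()
open import Data.Fin.Subset.Properties using (_∈?_)
open import Data.List using (foldl)
open import Data.Nat using (ℕ; zero; suc; NonZero; _+_; _*_; _<_)
open import Data.Nat.Properties
open import Data.Product using (_×_; _,_; proj₁; proj₂; ∃-syntax)
open import Data.Sum using (_⊎_; inj₁; inj₂)
open import Data.Unit using (⊤)
open import Function using (_∘_)
open import Relation.Binary.PropositionalEquality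
open import Relation.Nullary using (yes; no; contradiction)
open import Relation.Nullary.Decidable using (map′)
open import Relation.Unary using (Pred; Decidable; _∈_; U)
open import Relation.Unary.Properties using (U?)
open import Level using (0ℓ)
open import Defs

module _ {ℓ} {X : Set} {𝓛 : Family X ℓ} (lattice : IsLattice 𝓛) where
  open IsLattice lattice

  -- Since 𝓛 need not contain ∅ or X, finite unions and intersections carry an
  -- unconditional member G.
  module _ {D : Pred ℕ 0ℓ} (D? : Decidable D) {F : ℕ → Pred X 0ℓ} {G : Pred X 0ℓ}
           (F∈ : ∀ t → F t ∈ 𝓛) (G∈ : G ∈ 𝓛) where

    ⋂-closed : ∀ n → (λ x → x ∈ G × (∀ t → t < n → t ∈ D → x ∈ F t)) ∈ 𝓛
    ⋂-closed zero    = resp-≐ ((λ g → g , λ _ ()) , proj₁) G∈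
    -- Whether `F n` joins the intersection depends on `n ∈ D`, which constructively has to be
    -- decided.
    ⋂-closed (suc n) with D? n
    ... | yes d = resp-≐
      ( (λ { ((g , h) , f) → g , λ t t<1+n dt → case-last h (λ _ → f) t<1+n dt })
      , (λ (g , h) → (g , λ t → h t ∘ m<n⇒m<1+n) , h n (n<1+n n) d))
      (∩-closed _ _ (⋂-closed n) (F∈ n))
      where
      case-last : ∀ {x} → (∀ t → t < n → t ∈ D → x ∈ F t) → (n ∈ D → x ∈ F n) →
                  ∀ {t} → t < suc n → t ∈ D → x ∈ F t
      case-last h f t<1+n dt with m<1+n⇒m<n∨m≡n t<1+n
      ... | inj₁ t<n  = h _ t<n dt
      ... | inj₂ refl = f dt
    ... | no ¬d = resp-≐
      ( (λ (g , h) → g , λ t t<1+n dt →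
           h t (≤∧≢⇒< (m<1+n⇒m≤n t<1+n) λ { refl → ¬d dt }) dt)
      , (λ (g , h) → g , λ t → h t ∘ m<n⇒m<1+n))
      (⋂-closed n)

    ⋃-closed : ∀ n → (λ x → x ∈ G ⊎ (∃[ t ] t < n × t ∈ D × x ∈ F t)) ∈ 𝓛
    ⋃-closed zero    = resp-≐ (inj₁ , λ { (inj₁ g) → g ; (inj₂ (_ , () , _)) }) G∈
    ⋃-closed (suc n) with D? n
    ... | yes d = resp-≐
      ( (λ { (inj₁ (inj₁ g)) → inj₁ g
           ; (inj₁ (inj₂ (t , t<n , h))) → inj₂ (t , m<n⇒m<1+n t<n , h)
           ; (inj₂ f) → inj₂ (n , n<1+n n , d , f) })
      , (λ { (inj₁ g) → inj₁ (inj₁ g)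
           ; (inj₂ (t , t<1+n , dt , f)) → case-last (m<1+n⇒m<n∨m≡n t<1+n) dt f }))
      (∪-closed _ _ (⋃-closed n) (F∈ n))
      where
      case-last : ∀ {x t} → t < n ⊎ t ≡ n → t ∈ D → x ∈ F t →
                  (x ∈ G ⊎ (∃[ t ] t < n × t ∈ D × x ∈ F t)) ⊎ x ∈ F n
      case-last (inj₁ t<n)  dt f = inj₁ (inj₂ (_ , t<n , dt , f))
      case-last (inj₂ refl) dt f = inj₂ f
    ... | no ¬d = resp-≐
      ( (λ { (inj₁ g) → inj₁ g
           ; (inj₂ (t , t<n , h)) → inj₂ (t , m<n⇒m<1+n t<n , h) })
      , (λ { (inj₁ g) → inj₁ g
           ; (inj₂ (t , t<1+n , dt , f)) → inj₂
               (t , ≤∧≢⇒< (m<1+n⇒m≤n t<1+n) (λ { refl → ¬d dt }) , dt , f) }))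
      (⋃-closed n)

-‿closed : ∀ {ℓ} {𝓛 : Family ℕ ℓ} → IsLattice 𝓛 → ClosedUnderDecrement 𝓛 →
           ∀ {L} → L ∈ 𝓛 → ∀ i → (L - i) ∈ 𝓛
-‿closed lattice dec {L} L∈ zero    = IsLattice.resp-≐ lattice
  ((λ {x} → subst L (sym (+-identityʳ x))) , (λ {x} → subst L (+-identityʳ x))) L∈
-‿closed lattice dec {L} L∈ (suc i) = IsLattice.resp-≐ lattice
  ((λ {x} → subst L (+-assoc x 1 i)) , (λ {x} → subst L (sym (+-assoc x 1 i))))
  (dec _ (-‿closed lattice dec L∈ i))

module _ (L : Pred ℕ 0ℓ) where

  _≼_ : ℕ → ℕ → Set
  a ≼ b = ∀ t → a ∈ L - t → b ∈ L - t

  -- The spare summand `c` makes the induction on `k` work: it collects the copies of `b` already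
  -- obtained, so the recursive call runs with `b + c`.
  ≼-*-+ : ∀ k {a b} → a ≼ b → ∀ c → k * a + c ∈ L → k * b + c ∈ L
  ≼-*-+ zero    a≼b c = λ z → z
  ≼-*-+ (suc k) {a} {b} a≼b c =
    subst L (trans (x∙yz≈y∙xz (k * b) b c) (sym (+-assoc b (k * b) c))) ∘
    ≼-*-+ k a≼b (b + c) ∘
    subst L (x∙yz≈y∙xz b (k * a) c) ∘
    a≼b (k * a + c) ∘
    subst L (+-assoc a (k * a) c)
    where open import Algebra.Properties.CommutativeSemigroup +-commutativeSemigroup

  ≼-* : ∀ k {a b} → a ≼ b → k * a ∈ L → k * b ∈ L
  ≼-* k {a} {b} a≼b =
    subst L (+-identityʳ (k * b)) ∘ ≼-*-+ k a≼b 0 ∘ subst L (sym (+-identityʳ (k * a)))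

  -- `≼` in both directions is the Nerode congruence of `L`; the bound expresses its finite index.
  Representatives : ℕ → Set
  Representatives n = ∀ a → ∃[ b ] b < n × a ≼ b × b ≼ a

  -- By commutativity of +, it is enough to test a ≼ b on representatives t.
  ≼-finite : ∀ {n} → Representatives n → ∀ {a b} →
             (∀ t → t < n → a ∈ L - t → b ∈ L - t) → a ≼ b
  ≼-finite rep {a} {b} h t a+t∈L =
    let t′ , t′<n , t≼t′ , t′≼t = rep t in
    subst L (+-comm t b) (t′≼t b (subst L (+-comm b t′)
      (h t′ t′<n (subst L (+-comm t′ a) (t≼t′ a (subst L (+-comm a t) a+t∈L))))))

module _ (M : Automaton ⊤) where
  open Automaton M

  state : ℕ → Fin size
  state n = foldl step start (unary n)

  foldl-unary-+ : ∀ q m n → foldl step q (unary (m + n)) ≡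
                            foldl step (foldl step q (unary m)) (unary n)
  foldl-unary-+ q zero    n = refl
  foldl-unary-+ q (suc m) n = foldl-unary-+ (step q _) m n

  state-+-cong : ∀ {a b} → state a ≡ state b → ∀ t → state (a + t) ≡ state (b + t)
  state-+-cong {a} {b} eq t = begin
    state (a + t)                      ≡⟨ foldl-unary-+ start a t ⟩
    foldl step (state a) (unary t)     ≡⟨ cong (λ q → foldl step q (unary t)) eq ⟩
    foldl step (state b) (unary t)     ≡⟨ foldl-unary-+ start b t ⟨
    state (b + t)                      ∎
    where open ≡-Reasoning

  -- The state sequence is eventually periodic: once the state at `j` repeats the one at some
  -- `i < j`, no new state appears.
  state-representatives : ∃[ n ] (∀ a → ∃[ b ] b < n × state a ≡ state b)
  state-representatives
    with i , j , i<j , qi≡qj ← pigeonhole (n<1+n size) (state ∘ toℕ) = toℕ j , rep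
    where
    rep : ∀ a → ∃[ b ] b < toℕ j × state a ≡ state b
    rep zero    = 0 , m<n⇒0<n i<j , refl
    rep (suc a) with b , b<j , eq ← rep a
                with m≤n⇒m<n∨m≡n b<j
                   | subst₂ (λ m n → state m ≡ state n) (+-comm a 1) (+-comm b 1)
                       (state-+-cong {a} {b} eq 1)
    ... | inj₁ 1+b<j | eq′ = suc b , 1+b<j , eq′
    -- The successor has run into `j`, so it wraps around to `i`.
    ... | inj₂ 1+b≡j | eq′ =
      toℕ i , i<j , trans eq′ (trans (cong state 1+b≡j) (sym qi≡qj))

module _ {L : Pred ℕ 0ℓ} where

  Regular⇒Decidable : Regular L → Decidable L
  Regular⇒Decidable (M , L⊆M , M⊆L) n =
    map′ M⊆L L⊆M (state M n ∈? Automaton.final M)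

  -- Numbers that lead to the same state accept the same continuations.
  Regular⇒Representatives : Regular L → ∃[ n ] Representatives L n
  Regular⇒Representatives (M , L⊆M , M⊆L) =
    let n , rep = state-representatives M in
    n , λ a → let b , b<n , eq = rep a in
      b , b<n , ≼-intro {a} {b} eq , ≼-intro {b} {a} (sym eq)
    where
    ≼-intro : ∀ {a b} → state M a ≡ state M b → _≼_ L a b
    ≼-intro {a} {b} eq t =
      M⊆L ∘ subst (Subset._∈ Automaton.final M) (state-+-cong M {a} {b} eq t) ∘ L⊆M

theorem2p1 : ∀ {ℓ} (k : ℕ) .{{_ : NonZero k}} (𝓛 : Family ℕ ℓ) →
    IsLattice 𝓛 → (∀ L → L ∈ 𝓛 → Regular L) →
    ClosedUnderDecrement 𝓛 → ClosedUnderQuotient k 𝓛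
-- Quotient by `0` gives the empty set or all of `ℕ`, which `𝓛` may lack. With `suc k`, `suc k * a`
-- unfolds to `a + k * a`, so its membership in `L` reads `a ∈ L - k * a`.
theorem2p1 (suc k) 𝓛 lattice regular dec L L∈ =
  IsLattice.resp-≐ lattice (⊆÷ , ÷⊆)
    (⋃-closed lattice (L? ∘ (suc k *_)) up∈ all∈ n)
  where
  L? : Decidable L
  L? = Regular⇒Decidable (regular L L∈)

  n : ℕ
  n = proj₁ (Regular⇒Representatives (regular L L∈))

  rep : Representatives L n
  rep = proj₂ (Regular⇒Representatives (regular L L∈))

  L-∈ : ∀ i → (L - i) ∈ 𝓛
  L-∈ = -‿closed lattice dec L∈

  -- When suc k * a ∈ L this is { x ∣ a ≼ x }: the first factor is then one of
  -- the L - t with a + t ∈ L.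
  Up : ℕ → Pred ℕ 0ℓ
  Up a x = x ∈ L - k * a × (∀ t → t < n → a ∈ L - t → x ∈ L - t)

  up∈ : ∀ a → Up a ∈ 𝓛
  up∈ a = ⋂-closed lattice (L? ∘ (a +_)) L-∈ (L-∈ (k * a)) n

  -- Always contained in L ÷ suc k, it stands in for ∅ in the union.
  All : Pred ℕ 0ℓ
  All x = x ∈ L × (∀ t → t < n → t ∈ U → x ∈ L - t)

  all∈ : All ∈ 𝓛
  all∈ = ⋂-closed lattice U? L-∈ L∈ n

  ⊆÷ : ∀ {x} → x ∈ All ⊎ (∃[ a ] a < n × suc k * a ∈ L × x ∈ Up a) → x ∈ L ÷ suc k
  ⊆÷ {x} (inj₁ (_ , all)) =
    -- `All` covers every shift below `n`, in particular the representative of `k * x`.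
    let t , t<n , _ , t≼kx = rep (k * x) in
    subst L (+-comm (k * x) x) (t≼kx x (subst L (+-comm x t) (all t t<n _)))
  ⊆÷ (inj₂ (a , _ , ka∈L , _ , a≼x)) =
    ≼-* L (suc k) (≼-finite L rep a≼x) ka∈L

  ÷⊆ : ∀ {x} → x ∈ L ÷ suc k → x ∈ All ⊎ (∃[ a ] a < n × suc k * a ∈ L × x ∈ Up a)
  ÷⊆ {x} kx∈L =
    let a , a<n , x≼a , a≼x = rep x
        ka∈L = ≼-* L (suc k) x≼a kx∈L
    -- The first factor of `Up a` is `a ≼ x` tested at `k * a`.
    in inj₂ (a , a<n , ka∈L , a≼x (k * a) ka∈L , λ t _ → a≼x t)
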